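{- Let $\varphi_5:\mathbb{N}\to\mathbb{N}$ be the function defined as follows. The values $\varphi_5(0),\varphi_5(1),\dots,\varphi_5(29)$ are, in order, $$5,4,6,7,1,0,2,3,11,10,\ 9,8,15,14,13,12,19,18,17,16,\ 23,22,21,20,27,26,25,24,29,28,$$ and for $x\ge 30$, $\varphi_5(x)=x\oplus_2 3$. Then, for all nonnegative integers $a,b$, the Halve Nim position $a^1b^15^1$ is a $\mathcal{P}$-position if and only if $b=\varphi_5(a)$. Furthermore, for $a,b\ge 30$, $a^1b^15^1$ is a $\mathcal{P}$-position if and only if $(a+2)\oplus(b+2)=3$.
   Context: $\mathbb{N}$ is the set of nonnegative integers and $\oplus$ denotes bitwise XOR. The $n$-shifted bitwise sum is $x\oplus_n y=\bigl((x+n)\oplus y\bigr)-n$. Halve Nim is a two-player game played on finitely many piles of coins; players alternate moves and a player who cannot move loses. A move is one of: (i) choose one pile and remove at least one coin from it; (ii) halve the game: simultaneously replace every pile of $m$ coins by a pile of $\lfloor m/2\rfloor$ coins. When there are no coins left, no move is available (halving requires at least one coin to be present). A position is a $\mathcal{P}$-position if the player who is not about to move has a winning strategy (equivalently, every move from it leads to an $\mathcal{N}$-position), and an $\mathcal{N}$-position if the player about to move has a winning strategy. $a^1b^1c^1$ denotes the position with three piles of sizes $a$, $b$, $c$ (a pile of size $0$ is an empty pile); in particular $a^1b^15^1$ has piles of sizes $a$, $b$, $5$. -}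

module Defs where

open import Data.Fin.Base using (Fin; fromℕ<)
open import Data.List.Base using (List; length; lookup; map; _[_]∷=_)
open import Data.List.Relation.Unary.Any using (Any)
open import Data.Nat.Base using (ℕ; zero; suc; _+_; _*_; _∸_; _<_; ⌊_/2⌋)
open import Data.Nat.DivMod using (_%_)
open import Data.Nat.Properties using (_<?_)
open import Data.Vec.Base as Vec using (Vec; []; _∷_)
open import Relation.Nullary.Decidable using (yes; no)

infixl 6 _⊕_ _⊕[_]_

-- XOR of the k lowest binary digits of m and n.
xorBits : (k m n : ℕ) → ℕ
xorBits zero    m n = 0
xorBits (suc k) m n = (m % 2 + n % 2) % 2 + 2 * xorBits k ⌊ m /2⌋ ⌊ n /2⌋

-- m and n both have at most m + n binary digits, so no digit is lost.
_⊕_ : ℕ → ℕ → ℕ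
m ⊕ n = xorBits (m + n) m n

-- The value may be negative when the subtraction is taken in ℤ; the truncated
-- subtraction agrees with it whenever n ≤ (x + n) ⊕ y, in particular for
-- n = 2, y = 3 and x ≥ 30, as (x + 2) ⊕ 3 ≥ (x + 2) ∸ 3.
_⊕[_]_ : ℕ → ℕ → ℕ → ℕ
x ⊕[ n ] y = ((x + n) ⊕ y) ∸ n

Position : Set
Position = List ℕ

data Move : Position → Position → Set where
  remove : ∀ {p} (i : Fin (length p)) {m} → m < lookup p i → Move p (p [ i ]∷= m)
  halve  : ∀ {p} → Any (0 <_) p → Move p (map ⌊_/2⌋ p)

-- An element of IsP p (IsN p) is a winning strategy for the player who is not
-- (who is) about to move; being inductive, it wins after finitely many moves.
mutual
  data IsP (p : Position) : Set where
    allMovesToN : (∀ {q} → Move p q → IsN q) → IsP p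

  data IsN (p : Position) : Set where
    someMoveToP : ∀ {q} → Move p q → IsP q → IsN p

φ₅-table : Vec ℕ 30
φ₅-table =
   5 ∷  4 ∷  6 ∷  7 ∷  1 ∷  0 ∷  2 ∷  3 ∷ 11 ∷ 10 ∷
   9 ∷  8 ∷ 15 ∷ 14 ∷ 13 ∷ 12 ∷ 19 ∷ 18 ∷ 17 ∷ 16 ∷
  23 ∷ 22 ∷ 21 ∷ 20 ∷ 27 ∷ 26 ∷ 25 ∷ 24 ∷ 29 ∷ 28 ∷ []

φ₅ : ℕ → ℕ
φ₅ x with x <? 30
... | yes x<30 = Vec.lookup φ₅-table (fromℕ< x<30)
... | no  _    = x ⊕[ 2 ] 3

{-# OPTIONS --safe #-}

-- Since halving a third pile of size 5 yields one of size 2, the triples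
-- (a, b, c) are treated for all c < 6 at once.  For each c the 𝒫-positions are
-- the graph of an involution φ c that moves every number by at most 5.  For
-- x ≥ 30, φ 4 x = x ⊕₂ 2, φ 5 x = x ⊕₂ 3, and for c < 4, φ c x is x ⊕ (c ⊕ 2)
-- or x ⊕ c according to the parity of ⌊log₂ (x / 28)⌋.  That the graphs are
-- closed and absorbing for the game only involves the values near a and near
-- ⌊a/2⌋.  For a < 68 this is a computation; for larger a, translation by a
-- multiple of 8 reduces it to a computation for each of the possible parities
-- of two consecutive blocks.

module Submission where

open import Defs
open import Data.Bool.Base using (true; false; if_then_else_)
open import Data.Fin.Base using (Fin; zero; suc; fromℕ<)
open import Data.List.Base using (_∷_; []; length; lookup; map; _[_]∷=_)
open import Data.List.Relation.Unary.Any using (Any; here; there)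
open import Data.Nat.Base
open import Data.Nat.DivMod
open import Data.Nat.Divisibility using (∣-refl; n∣m*n)
open import Data.Nat.Induction using (<-wellFounded)
open import Data.Nat.ListAction using (sum)
open import Data.Nat.Logarithm using (⌊log₂_⌋; ⌊log₂⌋-mono-≤; ⌊log₂⌊n/2⌋⌋≡⌊log₂n⌋∸1)
open import Data.Nat.Properties
open import Algebra.Properties.CommutativeSemigroup +-commutativeSemigroup using (x∙yz≈y∙xz)
open import Data.Parity.Base using (Parity; 0ℙ; 1ℙ; _⁻¹)
open import Data.Parity.Properties using (suc-homo-⁻¹; ⁻¹-involutive)
open import Data.Product.Base using (_×_; _,_; ∃)
open import Data.Sum.Base using (_⊎_; inj₁; inj₂; [_,_]′)
open import Data.Vec.Base as Vec using (Vec; []; _∷_)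
open import Function.Bundles using (_⇔_; mk⇔)
open import Function.Construct.Composition using (_⇔-∘_)
open import Induction.WellFounded using (Acc; acc)
open import Relation.Binary.Definitions using (tri<; tri≈; tri>)
open import Relation.Binary.PropositionalEquality
open import Relation.Nullary using (¬_; Dec; yes; no; contradiction)
open import Relation.Nullary.Reflects using (ofʸ)
open import Relation.Unary using (Decidable)
open import Relation.Nullary.Decidable using (decidable-stable; from-yes; map′; ¬?; _×-dec_; _⊎-dec_; _→-dec_)

-- Halving and binary digits

n≤1+k⇒⌊n/2⌋≤k : ∀ {n k} → n ≤ suc k → ⌊ n /2⌋ ≤ k
n≤1+k⇒⌊n/2⌋≤k {zero}  _       = z≤n
n≤1+k⇒⌊n/2⌋≤k {suc n} (s≤s p) = ≤-trans (s≤s⁻¹ (⌊n/2⌋<n n)) p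

n%2+2*⌊n/2⌋≡n : ∀ n → n % 2 + 2 * ⌊ n /2⌋ ≡ n
n%2+2*⌊n/2⌋≡n zero          = refl
n%2+2*⌊n/2⌋≡n (suc zero)    = refl
n%2+2*⌊n/2⌋≡n (suc (suc n)) = begin
  n % 2 + 2 * suc ⌊ n /2⌋   ≡⟨ cong (n % 2 +_) (*-suc 2 ⌊ n /2⌋) ⟩
  n % 2 + (2 + 2 * ⌊ n /2⌋) ≡⟨ x∙yz≈y∙xz (n % 2) 2 _ ⟩
  2 + (n % 2 + 2 * ⌊ n /2⌋) ≡⟨ cong (2 +_) (n%2+2*⌊n/2⌋≡n n) ⟩
  2 + n                     ∎
  where open ≡-Reasoning

[b+2*n]%2≡b : ∀ {b} n → b < 2 → (b + 2 * n) % 2 ≡ b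
[b+2*n]%2≡b {b} n b<2 = begin
  (b + 2 * n) % 2 ≡⟨ cong (λ k → (b + k) % 2) (*-comm 2 n) ⟩
  (b + n * 2) % 2 ≡⟨ [m+kn]%n≡m%n b n 2 ⟩
  b % 2           ≡⟨ m<n⇒m%n≡m b<2 ⟩
  b               ∎
  where open ≡-Reasoning

⌊b+2*n/2⌋≡n : ∀ {b} n → b < 2 → ⌊ b + 2 * n /2⌋ ≡ n
⌊b+2*n/2⌋≡n {0} n _ = sym (n≡⌊n+n/2⌋′ n)
  where
  n≡⌊n+n/2⌋′ : ∀ n → n ≡ ⌊ 2 * n /2⌋
  n≡⌊n+n/2⌋′ n = trans (n≡⌊n+n/2⌋ n) (cong (λ k → ⌊ n + k /2⌋) (sym (+-identityʳ n)))
⌊b+2*n/2⌋≡n {1} zero    _ = refl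
⌊b+2*n/2⌋≡n {1} (suc n) b<2 = trans (cong (λ k → ⌊ suc k /2⌋) (*-suc 2 n)) (cong suc (⌊b+2*n/2⌋≡n n b<2))
⌊b+2*n/2⌋≡n {suc (suc _)} n (s≤s (s≤s ()))

⌊k*2+n/2⌋≡k+⌊n/2⌋ : ∀ k n → ⌊ k * 2 + n /2⌋ ≡ k + ⌊ n /2⌋
⌊k*2+n/2⌋≡k+⌊n/2⌋ zero    n = refl
⌊k*2+n/2⌋≡k+⌊n/2⌋ (suc k) n = cong suc (⌊k*2+n/2⌋≡k+⌊n/2⌋ k n)

n/2≡⌊n/2⌋ : ∀ n → n / 2 ≡ ⌊ n /2⌋
n/2≡⌊n/2⌋ zero          = refl
n/2≡⌊n/2⌋ (suc zero)    = refl
n/2≡⌊n/2⌋ (suc (suc n)) = trans (+-distrib-/-∣ˡ {2} n ∣-refl) (cong suc (n/2≡⌊n/2⌋ n))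

-- Exclusive or

xorBits-identityʳ : ∀ {k n} → n ≤ k → xorBits k n 0 ≡ n
xorBits-identityʳ {zero}      z≤n = refl
xorBits-identityʳ {suc k} {n} n≤k = begin
  (n % 2 + 0) % 2 + 2 * xorBits k ⌊ n /2⌋ 0
    ≡⟨ cong₂ (λ b h → b % 2 + 2 * h) (+-identityʳ (n % 2)) (xorBits-identityʳ (n≤1+k⇒⌊n/2⌋≤k n≤k)) ⟩
  n % 2 % 2 + 2 * ⌊ n /2⌋
    ≡⟨ cong (_+ 2 * ⌊ n /2⌋) (m%n%n≡m%n n 2) ⟩
  n % 2 + 2 * ⌊ n /2⌋
    ≡⟨ n%2+2*⌊n/2⌋≡n n ⟩
  n ∎
  where open ≡-Reasoning

xorBits-zero : ∀ k → xorBits k 0 0 ≡ 0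
xorBits-zero k = xorBits-identityʳ {k} z≤n

-- Digits beyond the length of both numbers are zero. The crude bounds `m ≤ k`, `n ≤ k` survive the
-- recursion, since halving lowers a positive number by at least one.
xorBits-stable : ∀ {k l m n} → m ≤ k → n ≤ k → m ≤ l → n ≤ l → xorBits k m n ≡ xorBits l m n
xorBits-stable {zero}  {l}     z≤n z≤n _ _ = sym (xorBits-zero l)
xorBits-stable {suc k} {zero}  _ _ z≤n z≤n = xorBits-zero (suc k)
xorBits-stable {suc k} {suc l} {m} {n} p q r s =
  cong (λ h → (m % 2 + n % 2) % 2 + 2 * h)
    (xorBits-stable (n≤1+k⇒⌊n/2⌋≤k p) (n≤1+k⇒⌊n/2⌋≤k q) (n≤1+k⇒⌊n/2⌋≤k r) (n≤1+k⇒⌊n/2⌋≤k s))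

⊕≡xorBits : ∀ {k m n} → m ≤ k → n ≤ k → m ⊕ n ≡ xorBits k m n
⊕≡xorBits {_} {m} {n} = xorBits-stable (m≤m+n m n) (m≤n+m n m)

bit-cancel : ∀ {a b} → a < 2 → b < 2 → (a + (a + b) % 2) % 2 ≡ b
bit-cancel {0} {0} _ _ = refl
bit-cancel {0} {1} _ _ = refl
bit-cancel {1} {0} _ _ = refl
bit-cancel {1} {1} _ _ = refl
bit-cancel {suc (suc _)} (s≤s (s≤s ())) _
bit-cancel {_} {suc (suc _)} _ (s≤s (s≤s ()))

-- In each place the digit of `m` is added twice modulo 2, and `n ≤ k` ensures that every digit of
-- `n` is reached.
xorBits-cancel : ∀ {k} m {n} → n ≤ k → xorBits k m (xorBits k m n) ≡ n
xorBits-cancel {zero}  m     z≤n = refl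
xorBits-cancel {suc k} m {n} n≤k = begin
  (m % 2 + (b + 2 * x) % 2) % 2 + 2 * xorBits k ⌊ m /2⌋ ⌊ b + 2 * x /2⌋
    ≡⟨ cong₂ (λ b x → (m % 2 + b) % 2 + 2 * xorBits k ⌊ m /2⌋ x) ([b+2*n]%2≡b x b<2) (⌊b+2*n/2⌋≡n x b<2) ⟩
  (m % 2 + b) % 2 + 2 * xorBits k ⌊ m /2⌋ x
    ≡⟨ cong₂ (λ b x → b + 2 * x) (bit-cancel (m%n<n m 2) (m%n<n n 2)) (xorBits-cancel ⌊ m /2⌋ (n≤1+k⇒⌊n/2⌋≤k n≤k)) ⟩
  n % 2 + 2 * ⌊ n /2⌋
    ≡⟨ n%2+2*⌊n/2⌋≡n n ⟩
  n ∎
  where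
  open ≡-Reasoning
  b = (m % 2 + n % 2) % 2
  x = xorBits k ⌊ m /2⌋ ⌊ n /2⌋
  b<2 = m%n<n (m % 2 + n % 2) 2

⊕-transpose : ∀ m n {d} → m ⊕ n ≡ d → n ≡ m ⊕ d
⊕-transpose m n {d} refl = begin
  n                             ≡⟨ xorBits-cancel m n≤k ⟨
  xorBits k m (xorBits k m n)   ≡⟨ cong (xorBits k m) (⊕≡xorBits m≤k n≤k) ⟨
  xorBits k m (m ⊕ n)           ≡⟨ ⊕≡xorBits m≤k (m≤n+m (m ⊕ n) (m + n)) ⟨
  m ⊕ (m ⊕ n)                   ∎
  where
  open ≡-Reasoning
  -- A common digit count, large enough for `m`, `n` and `m ⊕ n`.
  k = m + n + (m ⊕ n)
  m≤k = ≤-trans (m≤m+n m n) (m≤m+n (m + n) (m ⊕ n))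
  n≤k = ≤-trans (m≤n+m n m) (m≤m+n (m + n) (m ⊕ n))

d<4⇒⌊⌊d/2⌋/2⌋≡0 : ∀ {d} → d < 4 → ⌊ ⌊ d /2⌋ /2⌋ ≡ 0
d<4⇒⌊⌊d/2⌋/2⌋≡0 {0} _ = refl
d<4⇒⌊⌊d/2⌋/2⌋≡0 {1} _ = refl
d<4⇒⌊⌊d/2⌋/2⌋≡0 {2} _ = refl
d<4⇒⌊⌊d/2⌋/2⌋≡0 {3} _ = refl
d<4⇒⌊⌊d/2⌋/2⌋≡0 {suc (suc (suc (suc _)))} (s≤s (s≤s (s≤s (s≤s ()))))

-- As `d` has at most two binary digits, only the two lowest digits change, while adding 4 affects
-- only the quotient by 4. Both sides are unfolded by two digits and compared.
4+n⊕d : ∀ n {d} → d < 4 → (4 + n) ⊕ d ≡ 4 + (n ⊕ d)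
4+n⊕d n {d} d<4 = begin
  b + 2 * (b′ + 2 * xorBits (2 + n + d) (suc n″) d″)
    ≡⟨ cong (λ h → b + 2 * (b′ + 2 * h)) (high (suc n″) (s≤s (≤-trans n″≤n (≤-trans (m≤m+n n d) (n≤1+n (n + d)))))) ⟩
  b + 2 * (b′ + 2 * suc n″)
    ≡⟨ carry ⟩
  4 + (b + 2 * (b′ + 2 * n″))
    ≡⟨ cong (λ h → 4 + (b + 2 * (b′ + 2 * h))) (high n″ (≤-trans n″≤n (m≤m+n n d))) ⟨
  4 + xorBits (2 + n + d) n d
    ≡⟨ cong (4 +_) (⊕≡xorBits (≤-trans (m≤m+n n d) (m≤n+m (n + d) 2)) (m≤n+m d (2 + n))) ⟨
  4 + (n ⊕ d) ∎
  where
  open ≡-Reasoning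
  b  = (n % 2 + d % 2) % 2
  b′ = (⌊ n /2⌋ % 2 + ⌊ d /2⌋ % 2) % 2
  n″ = ⌊ ⌊ n /2⌋ /2⌋
  d″ = ⌊ ⌊ d /2⌋ /2⌋
  n″≤n : n″ ≤ n
  n″≤n = ≤-trans (⌊n/2⌋≤n ⌊ n /2⌋) (⌊n/2⌋≤n n)
  high : ∀ {k} m → m ≤ k → xorBits k m d″ ≡ m
  high {k} m m≤k = trans (cong (xorBits k m) (d<4⇒⌊⌊d/2⌋/2⌋≡0 d<4)) (xorBits-identityʳ m≤k)
  carry : b + 2 * (b′ + 2 * suc n″) ≡ 4 + (b + 2 * (b′ + 2 * n″))
  carry = begin
    b + 2 * (b′ + 2 * suc n″)     ≡⟨ cong (λ h → b + 2 * (b′ + h)) (*-suc 2 n″) ⟩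
    b + 2 * (b′ + (2 + 2 * n″))   ≡⟨ cong (λ h → b + 2 * h) (x∙yz≈y∙xz b′ 2 _) ⟩
    b + 2 * (2 + (b′ + 2 * n″))   ≡⟨ cong (b +_) (*-distribˡ-+ 2 2 (b′ + 2 * n″)) ⟩
    b + (4 + 2 * (b′ + 2 * n″))   ≡⟨ x∙yz≈y∙xz b 4 _ ⟩
    4 + (b + 2 * (b′ + 2 * n″))   ∎

⊕-shift : ∀ m n {d} → d < 4 → (m * 4 + n) ⊕ d ≡ m * 4 + (n ⊕ d)
⊕-shift zero    n d<4 = refl
⊕-shift (suc m) n d<4 = trans (4+n⊕d (m * 4 + n) d<4) (cong (4 +_) (⊕-shift m n d<4))

-- The 𝒫-positions with a third pile of size below 6

-- The regime of the block {4m, 4m + 1, 4m + 2, 4m + 3}; it changes at the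
-- numbers 7 · 2ᵏ with k ≥ 3.
regime : ℕ → Parity
regime m = parity ⌊log₂ (m / 7) ⌋

twist : ℕ → Parity → ℕ
twist c 0ℙ = c ⊕ 2
twist c 1ℙ = c

-- The regime assignment is a parameter so that the same formula can be evaluated on a small window
-- with prescribed regimes.
mate : (ℕ → Parity) → ℕ → ℕ → ℕ
mate r c x = if c <ᵇ 4 then x ⊕ twist c (r (x / 4)) else x ⊕[ 2 ] (c ∸ 2)

φ-table : ℕ → Vec ℕ 30
φ-table 0 =
   0 ∷  2 ∷  1 ∷  3 ∷  4 ∷  5 ∷  8 ∷  9 ∷  6 ∷  7 ∷
  12 ∷ 13 ∷ 10 ∷ 11 ∷ 14 ∷ 15 ∷ 16 ∷ 17 ∷ 18 ∷ 19 ∷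
  20 ∷ 21 ∷ 22 ∷ 23 ∷ 24 ∷ 25 ∷ 26 ∷ 27 ∷ 30 ∷ 31 ∷ []
φ-table 1 =
   2 ∷  3 ∷  0 ∷  1 ∷  5 ∷  4 ∷  9 ∷  8 ∷  7 ∷  6 ∷
  13 ∷ 12 ∷ 11 ∷ 10 ∷ 15 ∷ 14 ∷ 17 ∷ 16 ∷ 19 ∷ 18 ∷
  21 ∷ 20 ∷ 23 ∷ 22 ∷ 25 ∷ 24 ∷ 27 ∷ 26 ∷ 31 ∷ 30 ∷ []
φ-table 2 =
   1 ∷  0 ∷  2 ∷  4 ∷  3 ∷  6 ∷  5 ∷  7 ∷  8 ∷  9 ∷
  10 ∷ 11 ∷ 12 ∷ 13 ∷ 18 ∷ 19 ∷ 20 ∷ 21 ∷ 14 ∷ 15 ∷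
  16 ∷ 17 ∷ 26 ∷ 27 ∷ 28 ∷ 29 ∷ 22 ∷ 23 ∷ 24 ∷ 25 ∷ []
φ-table 3 =
   3 ∷  1 ∷  4 ∷  0 ∷  2 ∷  7 ∷  6 ∷  5 ∷  9 ∷  8 ∷
  11 ∷ 10 ∷ 13 ∷ 12 ∷ 19 ∷ 18 ∷ 21 ∷ 20 ∷ 15 ∷ 14 ∷
  17 ∷ 16 ∷ 27 ∷ 26 ∷ 29 ∷ 28 ∷ 23 ∷ 22 ∷ 25 ∷ 24 ∷ []
φ-table 4 =
   4 ∷  5 ∷  3 ∷  2 ∷  0 ∷  1 ∷  7 ∷  6 ∷ 10 ∷ 11 ∷
   8 ∷  9 ∷ 14 ∷ 15 ∷ 12 ∷ 13 ∷ 18 ∷ 19 ∷ 16 ∷ 17 ∷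
  22 ∷ 23 ∷ 20 ∷ 21 ∷ 26 ∷ 27 ∷ 24 ∷ 25 ∷ 28 ∷ 29 ∷ []
φ-table _ = φ₅-table

φ : ℕ → ℕ → ℕ
φ c x with x <? 30
... | yes x<30 = Vec.lookup (φ-table c) (fromℕ< x<30)
... | no  _    = mate regime c x

-- Both branches compute: the last clause of `φ-table` is `φ₅-table`, and `mate regime 5 x` reduces
-- to `x ⊕[ 2 ] 3`.
φ-5 : ∀ x → φ 5 x ≡ φ₅ x
φ-5 x with x <? 30
... | yes _ = refl
... | no  _ = refl

φ-mate : ∀ c {x} → 30 ≤ x → φ c x ≡ mate regime c x
φ-mate c {x} 30≤x with x <? 30
... | yes x<30 = contradiction 30≤x (<⇒≱ x<30)
... | no  _    = refl

-- Closure conditions and their finite verification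

all<? : ∀ {P : ℕ → Set} → Decidable P → ∀ v → Dec (∀ n → n < v → P n)
all<? P? v = map′ (λ p n → p {n}) (λ p {n} → p n) (allUpTo? P? v)

-- f stands for φ near a and h for φ near ⌊a/2⌋; `answered` only treats the
-- second piles b = a + k ≥ a, the others following by involutivity.
record Solves (f h : ℕ → ℕ → ℕ) (c a : ℕ) : Set where
  field
    involutive : f c (f c a) ≡ a
    bounded    : f c a ≤ 5 + a
    distinct   : ∀ c′ → c′ < c → f c′ a ≢ f c a
    unhalved   : 0 < a + c → h ⌊ c /2⌋ ⌊ a /2⌋ ≢ ⌊ f c a /2⌋
    answered   : ∀ k → k < 5 → a + k < f c a → a < f c (a + k) →
                 (∃ λ c′ → c′ < c × f c′ a ≡ a + k) ⊎ h ⌊ c /2⌋ ⌊ a /2⌋ ≡ ⌊ a + k /2⌋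

solves? : ∀ f h c a → Dec (Solves f h c a)
solves? f h c a =
  map′
    (λ (i , b , d , u , n) → record { involutive = i ; bounded = b ; distinct = d ; unhalved = u ; answered = n })
    (λ s → let open Solves s in involutive , bounded , distinct , unhalved , answered)
    (f c (f c a) ≟ a
     ×-dec f c a ≤? 5 + a
     ×-dec all<? (λ c′ → ¬? (f c′ a ≟ f c a)) c
     ×-dec (0 <? a + c →-dec ¬? (h ⌊ c /2⌋ ⌊ a /2⌋ ≟ ⌊ f c a /2⌋))
     ×-dec all<? (λ k → a + k <? f c a →-dec (a <? f c (a + k) →-dec
             (anyUpTo? (λ c′ → f c′ a ≟ a + k) c ⊎-dec h ⌊ c /2⌋ ⌊ a /2⌋ ≟ ⌊ a + k /2⌋))) 5)

-- The regimes of the 4-blocks q, q + 1 containing ⌊a/2⌋ and its neighbours, and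
-- (doubled) of the 4-blocks 2q, …, 2q + 3 containing a and its neighbours.
two : Parity → Parity → ℕ → Parity
two s t zero    = s
two s t (suc _) = t

doubled : (ℕ → Parity) → ℕ → Parity
doubled r i = r ⌊ i /2⌋ ⁻¹

-- The bounds keep `f c i` inside the window from 2 to 15 on which translation is valid, so that `f`
-- can be applied to it again.
LocallySolves : (s t : Parity) (c i : ℕ) → Set
LocallySolves s t c i = Solves f (mate (two s t)) c i × 2 ≤ f c i × f c i < 16
  where f = mate (doubled (two s t))

locallySolves? : ∀ s t c i → Dec (LocallySolves s t c i)
locallySolves? s t c i = solves? f (mate (two s t)) c i ×-dec 2 ≤? f c i ×-dec f c i <? 16
  where f = mate (doubled (two s t))

solves-<68 : ∀ a → a < 68 → ∀ c → c < 6 → Solves φ φ c a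
solves-<68 = from-yes (all<? (λ a → all<? (λ c → solves? φ φ c a) 6) 68)

locally? : ∀ s t → Dec (∀ i → i < 8 → ∀ c → c < 6 → LocallySolves s t c (4 + i))
locally? s t = all<? (λ i → all<? (λ c → locallySolves? s t c (4 + i)) 6) 8

-- The offsets 4 to 11 represent all residues modulo 8 and leave room for the neighbours:
-- `4 + i + k` is at most 15 for `k < 5`.
locallySolves : ∀ s t i → i < 8 → ∀ c → c < 6 → LocallySolves s t c (4 + i)
locallySolves 0ℙ 0ℙ = from-yes (locally? 0ℙ 0ℙ)
locallySolves 0ℙ 1ℙ = from-yes (locally? 0ℙ 1ℙ)
locallySolves 1ℙ 0ℙ = from-yes (locally? 1ℙ 0ℙ)
locallySolves 1ℙ 1ℙ = from-yes (locally? 1ℙ 1ℙ)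

-- Translation to large numbers

-- Division by 7 commutes with halving, and halving lowers the logarithm by one; `14 ≤ n` makes the
-- logarithm of `n / 7` positive, so `∸ 1` does not truncate.
regime-halve : ∀ {n} → 14 ≤ n → regime n ≡ regime ⌊ n /2⌋ ⁻¹
regime-halve {n} 14≤n = begin
  parity ⌊log₂ (n / 7) ⌋                  ≡⟨ cong parity (m+[n∸m]≡n (⌊log₂⌋-mono-≤ (/-monoˡ-≤ 7 14≤n))) ⟨
  parity (suc l)                          ≡⟨ ⁻¹-involutive _ ⟨
  parity (suc l) ⁻¹ ⁻¹                    ≡⟨ cong _⁻¹ (suc-homo-⁻¹ l) ⟩
  parity l ⁻¹                             ≡⟨ cong (λ l → parity l ⁻¹) (⌊log₂⌊n/2⌋⌋≡⌊log₂n⌋∸1 (n / 7)) ⟨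
  parity ⌊log₂ ⌊ n / 7 /2⌋ ⌋ ⁻¹           ≡⟨ cong (λ k → parity ⌊log₂ k ⌋ ⁻¹) swap ⟩
  parity ⌊log₂ (⌊ n /2⌋ / 7) ⌋ ⁻¹         ∎
  where
  open ≡-Reasoning
  l = ⌊log₂ (n / 7) ⌋ ∸ 1
  swap : ⌊ n / 7 /2⌋ ≡ ⌊ n /2⌋ / 7
  swap = begin
    ⌊ n / 7 /2⌋   ≡⟨ n/2≡⌊n/2⌋ (n / 7) ⟨
    n / 7 / 2     ≡⟨ m/n/o≡m/[n*o] n 7 2 ⟩
    n / 14        ≡⟨ m/n/o≡m/[n*o] n 2 7 ⟨
    n / 2 / 7     ≡⟨ cong (_/ 7) (n/2≡⌊n/2⌋ n) ⟩
    ⌊ n /2⌋ / 7   ∎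

regime-two : ∀ q {i} → i < 2 → regime (q + i) ≡ two (regime q) (regime (suc q)) i
regime-two q {0} _ = cong regime (+-identityʳ q)
regime-two q {1} _ = cong regime (+-comm q 1)
regime-two q {suc (suc _)} (s≤s (s≤s ()))

regime-doubled : ∀ q {i} → 7 ≤ q → i < 4 →
                 regime (q * 2 + i) ≡ doubled (two (regime q) (regime (suc q))) i
regime-doubled q {i} 7≤q i<4 = begin
  regime (q * 2 + i)             ≡⟨ regime-halve (≤-trans (*-monoˡ-≤ 2 7≤q) (m≤m+n (q * 2) i)) ⟩
  regime ⌊ q * 2 + i /2⌋ ⁻¹      ≡⟨ cong (λ k → regime k ⁻¹) (⌊k*2+n/2⌋≡k+⌊n/2⌋ q i) ⟩
  regime (q + ⌊ i /2⌋) ⁻¹        ≡⟨ cong _⁻¹ (regime-two q (s≤s (⌊n/2⌋-mono (s≤s⁻¹ i<4)))) ⟩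
  doubled (two (regime q) (regime (suc q))) i ∎
  where open ≡-Reasoning

twist<4 : ∀ c → c < 4 → ∀ p → twist c p < 4
twist<4 c c<4 0ℙ = from-yes (all<? (λ c → c ⊕ 2 <? 4) 4) c c<4
twist<4 c c<4 1ℙ = c<4

-- A number that is at least 4 has a digit above the two lowest, which `d` cannot clear. The form
-- `2 + j + 2` fits the substitution of `2 + (j ∸ 2)` for `j` in `mate-shift`.
2≤[4+j]⊕d : ∀ d → d < 4 → ∀ j → j < 14 → 2 ≤ (2 + j + 2) ⊕ d
2≤[4+j]⊕d = from-yes (all<? (λ d → all<? (λ j → 2 ≤? (2 + j + 2) ⊕ d) 14) 4)

mate-cong : ∀ {r r′} c x → r (x / 4) ≡ r′ (x / 4) → mate r c x ≡ mate r′ c x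
mate-cong c x eq = cong (λ p → if c <ᵇ 4 then x ⊕ twist c p else x ⊕[ 2 ] (c ∸ 2)) eq

-- The bound 2 ≤ j keeps the subtraction in mate r c j from being truncated.
mate-shift : ∀ r m {c j} → c < 6 → 2 ≤ j → j < 16 →
             mate r c (m * 4 + j) ≡ m * 4 + mate (λ i → r (m + i)) c j
mate-shift r m {c} {j} c<6 2≤j j<16 with c <ᵇ 4 | <ᵇ-reflects-< c 4
... | true  | ofʸ c<4 = begin
  (m * 4 + j) ⊕ twist c (r ((m * 4 + j) / 4))
    ≡⟨ cong (λ i → (m * 4 + j) ⊕ twist c (r i)) (trans (+-distrib-/-∣ˡ j (n∣m*n m)) (cong (_+ j / 4) (m*n/n≡m m 4))) ⟩
  (m * 4 + j) ⊕ twist c (r (m + j / 4))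
    ≡⟨ ⊕-shift m j (twist<4 c c<4 (r (m + j / 4))) ⟩
  m * 4 + (j ⊕ twist c (r (m + j / 4))) ∎
  where open ≡-Reasoning
... | false | _ = begin
  (m * 4 + j + 2) ⊕ d ∸ 2        ≡⟨ cong (λ x → x ⊕ d ∸ 2) (+-assoc (m * 4) j 2) ⟩
  (m * 4 + (j + 2)) ⊕ d ∸ 2      ≡⟨ cong (_∸ 2) (⊕-shift m (j + 2) d<4) ⟩
  m * 4 + ((j + 2) ⊕ d) ∸ 2      ≡⟨ +-∸-assoc (m * 4) 2≤ ⟩
  m * 4 + ((j + 2) ⊕ d ∸ 2)      ∎
  where
  open ≡-Reasoning
  d = c ∸ 2
  d<4 : d < 4
  d<4 = m<n+o⇒m∸n<o c 2 c<6
  2≤ : 2 ≤ (j + 2) ⊕ d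
  2≤ = subst (λ j → 2 ≤ (j + 2) ⊕ d) (m+[n∸m]≡n 2≤j) (2≤[4+j]⊕d d d<4 (j ∸ 2) (m<n+o⇒m∸n<o j 2 j<16))

-- With `8 ≤ m` the translated window starts at 32 or later, beyond the table.
φ-shift : ∀ m r {c j} → 8 ≤ m → r (j / 4) ≡ regime (m + j / 4) → c < 6 → 2 ≤ j → j < 16 →
          φ c (m * 4 + j) ≡ m * 4 + mate r c j
φ-shift m r {c} {j} 8≤m eq c<6 2≤j j<16 = begin
  φ c (m * 4 + j)                              ≡⟨ φ-mate c (≤-trans (m≤m+n 30 2) (≤-trans (*-monoˡ-≤ 4 8≤m) (m≤m+n (m * 4) j))) ⟩
  mate regime c (m * 4 + j)                    ≡⟨ mate-shift regime m c<6 2≤j j<16 ⟩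
  m * 4 + mate (λ i → regime (m + i)) c j      ≡⟨ cong (m * 4 +_) (mate-cong {r} {λ i → regime (m + i)} c j eq) ⟨
  m * 4 + mate r c j                           ∎
  where open ≡-Reasoning

module _ {f h f′ h′ : ℕ → ℕ → ℕ} (q : ℕ)
         (f-shift : ∀ {c j} → c < 6 → 2 ≤ j → j < 16 → f c (q * 2 * 4 + j) ≡ q * 2 * 4 + f′ c j)
         (h-shift : ∀ {c j} → c < 6 → 2 ≤ j → j < 8 → h c (q * 4 + j) ≡ q * 4 + h′ c j)
         where

  private
    N = q * 2 * 4

    ⌊N+_/2⌋ : ∀ n → ⌊ N + n /2⌋ ≡ q * 4 + ⌊ n /2⌋
    ⌊N+ n /2⌋ = trans (cong (λ k → ⌊ k + n /2⌋) N≡) (⌊k*2+n/2⌋≡k+⌊n/2⌋ (q * 4) n)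
      where
      N≡ : N ≡ q * 4 * 2
      N≡ = trans (*-assoc q 2 4) (sym (*-assoc q 4 2))

  -- Each condition is invariant under translation by `N` for `f` and by its half `q * 4` for `h`.
  -- The bounds on `f′ c i` allow `f-shift` at the mate itself, as involutivity requires.
  shift-solves : ∀ {c i} → c < 6 → 4 ≤ i → i < 12 → 2 ≤ f′ c i → f′ c i < 16 →
                 Solves f′ h′ c i → Solves f h c (N + i)
  shift-solves {c} {i} c<6 4≤i i<12 2≤f′i f′i<16 s = record
    { involutive = trans (cong (f c) (fN c<6)) (trans (f-shift c<6 2≤f′i f′i<16) (cong (N +_) s.involutive))
    ; bounded    = subst₂ _≤_ (sym (fN c<6)) (x∙yz≈y∙xz N 5 i) (+-monoʳ-≤ N s.bounded)
    ; distinct   = λ c′ c′<c eq → s.distinct c′ c′<c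
        (+-cancelˡ-≡ N _ _ (trans (sym (fN (<-trans c′<c c<6))) (trans eq (fN c<6))))
    ; unhalved   = λ _ eq → s.unhalved (≤-trans (≤-trans (s≤s z≤n) 4≤i) (m≤m+n i c))
        (+-cancelˡ-≡ (q * 4) _ _
          (trans (sym hN) (trans eq (trans (cong ⌊_/2⌋ (fN c<6)) ⌊N+ f′ c i /2⌋))))
    ; answered   = answer
    }
    where
    module s = Solves s
    2≤i = ≤-trans (m≤m+n 2 2) 4≤i

    fN : ∀ {c} → c < 6 → f c (N + i) ≡ N + f′ c i
    fN c<6 = f-shift c<6 2≤i (≤-trans i<12 (m≤m+n 12 4))

    hN : h ⌊ c /2⌋ ⌊ N + i /2⌋ ≡ q * 4 + h′ ⌊ c /2⌋ ⌊ i /2⌋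
    hN = trans (cong (h ⌊ c /2⌋) ⌊N+ i /2⌋)
           (h-shift (≤-<-trans (⌊n/2⌋≤n c) c<6) (⌊n/2⌋-mono 4≤i)
             (s≤s (≤-trans (⌊n/2⌋-mono (s≤s⁻¹ i<12)) (m≤m+n 5 2))))

    answer : ∀ k → k < 5 → N + i + k < f c (N + i) → N + i < f c (N + i + k) →
             (∃ λ c′ → c′ < c × f c′ (N + i) ≡ N + i + k) ⊎ h ⌊ c /2⌋ ⌊ N + i /2⌋ ≡ ⌊ N + i + k /2⌋
    answer k k<5 b<fa a<fb rewrite +-assoc N i k =
      [ (λ (c′ , c′<c , eq) → inj₁ (c′ , c′<c , trans (fN (<-trans c′<c c<6)) (cong (N +_) eq)))
      , (λ eq → inj₂ (trans hN (trans (cong (q * 4 +_) eq) (sym ⌊N+ i + k /2⌋))))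
      ]′ (s.answered k k<5 (+-cancelˡ-< N _ _ (subst (N + (i + k) <_) (fN c<6) b<fa))
            (+-cancelˡ-< N _ _ (subst (N + i <_)
              (f-shift c<6 (≤-trans 2≤i (m≤m+n i k)) (s≤s (+-mono-≤ (s≤s⁻¹ i<12) (s≤s⁻¹ k<5)))) a<fb)))

φ-solves : ∀ c → c < 6 → ∀ a → Solves φ φ c a
φ-solves c c<6 a with a <? 68
... | yes a<68 = solves-<68 a a<68 c c<6
... | no  a≮68 = subst (Solves φ φ c) (sym a≡) large
  where
  -- Subtracting 4 first places `a` at an offset from 4 to 11 in its window. From 68 on, `q` is at
  -- least 8.
  q = (a ∸ 4) / 8
  i = (a ∸ 4) % 8
  s = regime q
  t = regime (suc q)
  68≤a = ≮⇒≥ a≮68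

  8≤q : 8 ≤ q
  8≤q = /-monoˡ-≤ 8 (∸-monoˡ-≤ 4 68≤a)

  i<8 : i < 8
  i<8 = m%n<n (a ∸ 4) 8

  a≡ : a ≡ q * 2 * 4 + (4 + i)
  a≡ = begin
    a                      ≡⟨ m+[n∸m]≡n (≤-trans (m≤m+n 4 64) 68≤a) ⟨
    4 + (a ∸ 4)            ≡⟨ cong (4 +_) (m≡m%n+[m/n]*n (a ∸ 4) 8) ⟩
    4 + (i + q * 8)        ≡⟨ +-assoc 4 i (q * 8) ⟨
    4 + i + q * 8          ≡⟨ +-comm (4 + i) (q * 8) ⟩
    q * 8 + (4 + i)        ≡⟨ cong (_+ (4 + i)) (*-assoc q 2 4) ⟨
    q * 2 * 4 + (4 + i)    ∎
    where open ≡-Reasoning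

  large : Solves φ φ c (q * 2 * 4 + (4 + i))
  large = let (solved , 2≤ , <16) = locallySolves s t i i<8 c c<6 in
    shift-solves q
      (λ {_} {j} c<6 2≤j j<16 →
        φ-shift (q * 2) (doubled (two s t)) (≤-trans 8≤q (m≤m*n q 2))
          (sym (regime-doubled q (<⇒≤ 8≤q) (m<n*o⇒m/o<n j<16))) c<6 2≤j j<16)
      (λ {_} {j} c<6 2≤j j<8 →
        φ-shift q (two s t) 8≤q (sym (regime-two q (m<n*o⇒m/o<n j<8))) c<6 2≤j (≤-trans j<8 (m≤m+n 8 8)))
      c<6 (m≤m+n 4 i) (+-monoʳ-< 4 i<8) 2≤ <16 solved

transpose : ∀ {c a b} → c < 6 → b ≡ φ c a → a ≡ φ c b
transpose {c} {a} c<6 refl = sym (Solves.involutive (φ-solves c c<6 a))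

answer-≤ : ∀ {c a b} → c < 6 → a ≤ b → b < φ c a → a < φ c b →
           (∃ λ c′ → c′ < c × b ≡ φ c′ a) ⊎ ⌊ b /2⌋ ≡ φ ⌊ c /2⌋ ⌊ a /2⌋
answer-≤ {c} {a} c<6 a≤b b<φa a<φb with k , refl ← m≤n⇒∃[o]m+o≡n a≤b =
  [ (λ (c′ , c′<c , eq) → inj₁ (c′ , c′<c , sym eq)) , (λ eq → inj₂ (sym eq)) ]′
    -- The difference `k` of the piles is below 5 because `b < φ c a ≤ 5 + a`.
    (answered k (+-cancelˡ-< a k 5 (<-≤-trans b<φa (≤-trans bounded (≤-reflexive (+-comm 5 a))))) b<φa a<φb)
  where open Solves (φ-solves c c<6 a)

-- When neither of the first two piles can be lowered to match the other, lowering the third pile or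
-- halving must succeed. The case `b ≤ a` follows by exchanging the two piles.
answer : ∀ {c a b} → c < 6 → b < φ c a → a < φ c b →
         (∃ λ c′ → c′ < c × b ≡ φ c′ a) ⊎ ⌊ b /2⌋ ≡ φ ⌊ c /2⌋ ⌊ a /2⌋
answer {c} {a} {b} c<6 b<φa a<φb with ≤-total a b
... | inj₁ a≤b = answer-≤ c<6 a≤b b<φa a<φb
... | inj₂ b≤a =
  [ (λ (c′ , c′<c , eq) → inj₁ (c′ , c′<c , transpose (<-trans c′<c c<6) eq))
  , (λ eq → inj₂ (transpose (≤-<-trans (⌊n/2⌋≤n c) c<6) eq))
  ]′ (answer-≤ c<6 b≤a a<φb b<φa)

-- Winning strategies

IsP⇒¬IsN : ∀ {p} → IsP p → ¬ IsN p
IsP⇒¬IsN (allMovesToN f) (someMoveToP m p) = IsP⇒¬IsN p (f m)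


⌊/2⌋-< : ∀ {n} → 0 < n → ⌊ n /2⌋ < n
⌊/2⌋-< {suc n} _ = ⌊n/2⌋<n n

sum-halve-≤ : ∀ p → sum (map ⌊_/2⌋ p) ≤ sum p
sum-halve-≤ []      = z≤n
sum-halve-≤ (n ∷ p) = +-mono-≤ (⌊n/2⌋≤n n) (sum-halve-≤ p)

sum-halve-< : ∀ {p} → Any (0 <_) p → sum (map ⌊_/2⌋ p) < sum p
sum-halve-< (here {xs = p} 0<n)  = +-mono-<-≤ (⌊/2⌋-< 0<n) (sum-halve-≤ p)
sum-halve-< (there {x = n} some) = +-mono-≤-< (⌊n/2⌋≤n n) (sum-halve-< some)

sum-remove-< : ∀ p (i : Fin (length p)) {m} → m < lookup p i → sum (p [ i ]∷= m) < sum p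
sum-remove-< (n ∷ p) zero    m<n = +-monoˡ-< (sum p) m<n
sum-remove-< (n ∷ p) (suc i) m<  = +-monoʳ-< n (sum-remove-< p i m<)

sum-move-< : ∀ {p q} → Move p q → sum q < sum p
sum-move-< {p} (remove i m<) = sum-remove-< p i m<
sum-move-< (halve some)      = sum-halve-< some

-- The case `c = a = 0` is absurd, since `φ 0 0` computes to 0.
nonempty : ∀ {c a b} → b < φ c a → Any (0 <_) (a ∷ b ∷ c ∷ [])
nonempty {_}     {suc a} _ = here (s≤s z≤n)
nonempty {suc c} {zero}  _ = there (there (here (s≤s z≤n)))

0<a+c : ∀ {c a b} → b ≡ φ c a → Any (0 <_) (a ∷ b ∷ c ∷ []) → 0 < a + c
0<a+c {_}     {suc a} _ _ = s≤s z≤n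
0<a+c {suc c} {zero}  _ _ = s≤s z≤n
0<a+c {zero}  {zero}  refl (there (there (there ())))

mutual
  -- No move stays on the graphs: injectivity of `φ c` excludes the first pile, single-valuedness
  -- the second, `distinct` the third and `unhalved` halving. The recursion is on the number of
  -- coins.
  ≡φ⇒IsP : ∀ {c a b} → c < 6 → b ≡ φ c a → Acc _<_ (sum (a ∷ b ∷ c ∷ [])) → IsP (a ∷ b ∷ c ∷ [])
  ≡φ⇒IsP {c} {a} c<6 b≡φa (acc rs) = allMovesToN λ
    { move@(remove zero m<a) → ≢φ⇒IsN c<6
        (λ b≡φm → <⇒≢ m<a (trans (transpose c<6 b≡φm) (sym (transpose c<6 b≡φa))))
        (rs (sum-move-< move))
    ; move@(remove (suc zero) m<b) → ≢φ⇒IsN c<6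
        (λ m≡φa → <⇒≢ m<b (trans m≡φa (sym b≡φa)))
        (rs (sum-move-< move))
    ; move@(remove (suc (suc zero)) m<c) → ≢φ⇒IsN (<-trans m<c c<6)
        (λ b≡φa′ → distinct _ m<c (trans (sym b≡φa′) b≡φa))
        (rs (sum-move-< move))
    ; move@(halve some) → ≢φ⇒IsN (≤-<-trans (⌊n/2⌋≤n c) c<6)
        (λ eq → unhalved (0<a+c b≡φa some) (trans (sym eq) (cong ⌊_/2⌋ b≡φa)))
        (rs (sum-move-< move))
    }
    where open Solves (φ-solves c c<6 a)

  -- A pile exceeding the mate of the other is lowered to it; if both are below, `answer` supplies
  -- the move.
  ≢φ⇒IsN : ∀ {c a b} → c < 6 → b ≢ φ c a → Acc _<_ (sum (a ∷ b ∷ c ∷ [])) → IsN (a ∷ b ∷ c ∷ [])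
  ≢φ⇒IsN {c} {a} {b} c<6 b≢φa (acc rs) with <-cmp b (φ c a) | <-cmp a (φ c b)
  ... | tri≈ _ b≡φa _ | _ = contradiction b≡φa b≢φa
  ... | tri> _ _ φa<b | _ = someMoveToP move (≡φ⇒IsP c<6 refl (rs (sum-move-< move)))
    where
    move : Move (a ∷ b ∷ c ∷ []) (a ∷ φ c a ∷ c ∷ [])
    move = remove (suc zero) φa<b
  ... | tri< _ _ _ | tri≈ _ a≡φb _ = contradiction (transpose c<6 a≡φb) b≢φa
  ... | tri< _ _ _ | tri> _ _ φb<a =
    someMoveToP move (≡φ⇒IsP c<6 (transpose c<6 refl) (rs (sum-move-< move)))
    where
    move : Move (a ∷ b ∷ c ∷ []) (φ c b ∷ b ∷ c ∷ [])
    move = remove zero φb<a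
  ... | tri< b<φa _ _ | tri< a<φb _ _ with answer c<6 b<φa a<φb
  ...   | inj₁ (c′ , c′<c , b≡) =
    someMoveToP move (≡φ⇒IsP (<-trans c′<c c<6) b≡ (rs (sum-move-< move)))
    where
    move : Move (a ∷ b ∷ c ∷ []) (a ∷ b ∷ c′ ∷ [])
    move = remove (suc (suc zero)) c′<c
  ...   | inj₂ b≡ =
    someMoveToP move (≡φ⇒IsP (≤-<-trans (⌊n/2⌋≤n c) c<6) b≡ (rs (sum-move-< move)))
    where
    move : Move (a ∷ b ∷ c ∷ []) (⌊ a /2⌋ ∷ ⌊ b /2⌋ ∷ ⌊ c /2⌋ ∷ [])
    move = halve (nonempty b<φa)

-- Classification and the closed form for a third pile of size 5

IsP⇔φ : ∀ c → c < 6 → ∀ a b → IsP (a ∷ b ∷ c ∷ []) ⇔ (b ≡ φ c a)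
IsP⇔φ c c<6 a b = mk⇔
  (λ p → decidable-stable (b ≟ φ c a) (λ b≢φa → IsP⇒¬IsN p (≢φ⇒IsN c<6 b≢φa (<-wellFounded _))))
  (λ b≡φa → ≡φ⇒IsP c<6 b≡φa (<-wellFounded _))

IsP⇔φ₅ : ∀ a b → IsP (a ∷ b ∷ 5 ∷ []) ⇔ (b ≡ φ₅ a)
IsP⇔φ₅ a b = subst (λ x → IsP (a ∷ b ∷ 5 ∷ []) ⇔ (b ≡ x)) (φ-5 a) (IsP⇔φ 5 ≤-refl a b)

φ₅-⊕ : ∀ {a} → 30 ≤ a → φ₅ a ≡ (a + 2) ⊕ 3 ∸ 2
φ₅-⊕ {a} 30≤a = trans (sym (φ-5 a)) (φ-mate 5 30≤a)

-- Positivity of `b` rules out a truncated subtraction.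
≡∸2⇒≡+2 : ∀ {b x} → 1 ≤ b → b ≡ x ∸ 2 → x ≡ b + 2
≡∸2⇒≡+2 {x = suc (suc x)} _ refl = sym (+-comm x 2)
≡∸2⇒≡+2 {x = 0} () refl
≡∸2⇒≡+2 {x = 1} () refl

φ₅⇔⊕ : ∀ a b → 30 ≤ a → 30 ≤ b → (b ≡ φ₅ a) ⇔ ((a + 2) ⊕ (b + 2) ≡ 3)
φ₅⇔⊕ a b 30≤a 30≤b = mk⇔
  (λ b≡ → sym (⊕-transpose (a + 2) 3 (≡∸2⇒≡+2 (≤-trans (m≤m+n 1 29) 30≤b) (trans b≡ (φ₅-⊕ 30≤a)))))
  (λ eq → sym (begin
    φ₅ a               ≡⟨ φ₅-⊕ 30≤a ⟩
    (a + 2) ⊕ 3 ∸ 2    ≡⟨ cong (_∸ 2) (⊕-transpose (a + 2) (b + 2) eq) ⟨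
    b + 2 ∸ 2          ≡⟨ m+n∸n≡m b 2 ⟩
    b                  ∎))
  where open ≡-Reasoning

theorem29 : (∀ (a b : ℕ) → IsP (a ∷ b ∷ 5 ∷ []) ⇔ (b ≡ φ₅ a))
    × (∀ (a b : ℕ) → 30 ≤ a → 30 ≤ b → IsP (a ∷ b ∷ 5 ∷ []) ⇔ ((a + 2) ⊕ (b + 2) ≡ 3))
theorem29 = IsP⇔φ₅ , λ a b 30≤a 30≤b → φ₅⇔⊕ a b 30≤a 30≤b ⇔-∘ IsP⇔φ₅ a b
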